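{- Let $G$ be a graph and let $M$ be a module of $G$ with $|M|\ge 3$. Denote by $P_i$ the path on $i$ vertices, and define a graph $G'$ as follows. \begin{itemize} \item If $o(G[M])=\mathcal{D}$, let $G'$ be the graph obtained from $G$ by replacing $M$ by a copy of $P_2$. \item If $o(G[M])=\mathcal{S}$, let $G'$ be the graph obtained from $G$ by replacing $M$ by two independent (non-adjacent) vertices. \item If $o(G[M])=\mathcal{N}$, let $G'$ be the graph obtained from $G$ by replacing $M$ by a copy of $P_3$. \end{itemize} Then $G$ and $G'$ have the same outcome, i.e. $o(G)=o(G')$.
   Context: All graphs are finite, simple and undirected. $N[x]$ denotes the closed neighborhood of $x$, and $G[M]$ is the subgraph induced by $M$. The Maker-Breaker domination game on a graph $G$ is played by Dominator and Staller, who alternately claim one unclaimed vertex of $G$. Dominator wins if the vertices she claims contain a dominating set of $G$; otherwise (i.e. if Staller claims the whole closed neighborhood of some vertex) Staller wins. The outcome $o(G)$ is: $\mathcal{D}$ if Dominator has a winning strategy both playing first and playing second; $\mathcal{S}$ if Staller has a winning strategy both playing first and playing second; $\mathcal{N}$ if the player who moves first has a winning strategy. (These are the only possibilities.) A module of $G$ is a set $M\subseteq V(G)$ such that $N[x]\setminus M=N[y]\setminus M$ for all $x,y\in M$. A vertex outside $M$ is adjacent to $M$ if it is adjacent to all vertices of $M$. Replacing $M$ by a graph $H$ means: removing the vertices of $M$ from $G$, adding a copy of $H$, and adding all edges between vertices of $H$ and the vertices of $G\setminus M$ that were adjacent to $M$. -}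

module Defs where

open import Data.Bool.Base using (Bool; not; T)
open import Data.Bool.Properties using (T?; T-irrelevant)
open import Data.Empty using (⊥)
open import Data.Fin.Base using (Fin; toℕ)
import Data.Fin.Properties as Fin
open import Data.List.Base using (List; []; _∷_; _++_; map; mapMaybe; length; filter; filterᵇ; allFin)
open import Data.List.Membership.Propositional using (_∈_; find; lose)
open import Data.List.Membership.Propositional.Properties
  using (∈-map⁺; ∈-map⁻; ∈-++⁺ˡ; ∈-++⁺ʳ; ∈-allFin)
open import Data.List.Relation.Unary.All as All using (All; []; _∷_)
open import Data.List.Relation.Unary.AllPairs using ([]; _∷_)
open import Data.List.Relation.Unary.Any as Any using (here; there)
open import Data.List.Relation.Unary.Unique.Propositional using (Unique)
import Data.List.Relation.Unary.Unique.Propositional.Properties as Unique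
open import Data.Maybe.Base using (Maybe; just; nothing)
open import Data.Maybe.Properties using (≡-dec)
open import Data.Nat.Base using (ℕ; suc; _≤_; _<_; z≤n; s≤s)
import Data.Nat.Properties as ℕ
open import Data.Product.Base using (Σ; ∃; _×_; _,_; proj₁; proj₂; Σ-syntax; ∃-syntax)
open import Data.Sum.Base as Sum using (_⊎_; inj₁; inj₂)
open import Data.Sum.Properties using (inj₁-injective; inj₂-injective)
open import Function.Base using (_∘_; id)
open import Level using (0ℓ)
open import Relation.Binary.Core using (Rel)
import Relation.Binary.Definitions as B
open import Relation.Binary.Definitions using (DecidableEquality)
open import Relation.Binary.PropositionalEquality using (_≡_; _≢_; refl; sym; trans; cong)
open import Relation.Nullary.Decidable
  using (Dec; yes; no; isYes; map′; _×-dec_; _⊎-dec_; _→-dec_; toWitness; fromWitness)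
open import Relation.Nullary.Negation using (¬_; contradiction)
open import Relation.Unary using (Pred; _⊆_; _≐_; _∖_; _≬_; Decidable)

------------------------------------------------------------------------
-- Finite simple graphs

record Graph : Set₁ where
  infix 4 _~_ _~?_ _≟_
  field
    V        : Set
    _≟_      : DecidableEquality V
    vertices : List V
    complete : ∀ v → v ∈ vertices
    unique   : Unique vertices
    _~_      : Rel V 0ℓ
    _~?_     : B.Decidable _~_
    ~-sym    : B.Symmetric _~_
    ~-irrefl : ∀ {v} → ¬ (v ~ v)

  N[_] : V → Pred V 0ℓ
  N[ x ] y = y ≡ x ⊎ x ~ y

  N[_]? : ∀ x → Decidable N[ x ]
  N[ x ]? y = (y ≟ x) ⊎-dec (x ~? y)

  ∀? : ∀ {P : Pred V 0ℓ} → Decidable P → Dec (∀ v → P v)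
  ∀? P? = map′ (λ all v → All.lookup all (complete v)) (λ f → All.universal f vertices)
               (All.all? P? vertices)

  ∃? : ∀ {P : Pred V 0ℓ} → Decidable P → Dec (∃ P)
  ∃? P? = map′ (λ any → let (v , _ , pv) = find any in v , pv) (λ (v , pv) → lose (complete v) pv)
               (Any.any? P? vertices)

-- Subsets are given by Boolean characteristic functions; classically, on a
-- finite vertex set, this is every subset.
Subset : Graph → Set
Subset G = Graph.V G → Bool

elems : {A : Set} → (A → Bool) → Pred A 0ℓ
elems S v = T (S v)

card : (G : Graph) → Subset G → ℕ
card G S = length (filterᵇ S (Graph.vertices G))

IsModule : (G : Graph) → Subset G → Set
IsModule G M = ∀ x y → elems M x → elems M y →
               (N[ x ] ∖ elems M) ≐ (N[ y ] ∖ elems M)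
  where open Graph G

IsDominating : (G : Graph) → Pred (Graph.V G) 0ℓ → Set
IsDominating G S = ∀ x → Graph.N[_] G x ≬ S

------------------------------------------------------------------------
-- Constructions on graphs

module _ {A : Set} (S : A → Bool) where

  private
    keep : A → Maybe (Σ A (T ∘ S))
    keep a with T? (S a)
    ... | yes p = just (a , p)
    ... | no  _ = nothing

  restrict : List A → List (Σ A (T ∘ S))
  restrict = mapMaybe keep

  private
    Σ-≡ : ∀ {u v : Σ A (T ∘ S)} → proj₁ u ≡ proj₁ v → u ≡ v
    Σ-≡ {a , p} {.a , q} refl = cong (a ,_) (T-irrelevant p q)

  restrict-complete : ∀ {xs} (u : Σ A (T ∘ S)) → proj₁ u ∈ xs → u ∈ restrict xs
  restrict-complete {x ∷ _} (a , p) (here refl) with T? (S x)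
  ... | yes q = here (Σ-≡ refl)
  ... | no ¬q = contradiction p ¬q
  restrict-complete {x ∷ _} u (there i) with T? (S x)
  ... | yes _ = there (restrict-complete u i)
  ... | no  _ = restrict-complete u i

  private
    restrict-All : ∀ {x xs} (p : T (S x)) → All (x ≢_) xs → All ((x , p) ≢_) (restrict xs)
    restrict-All p [] = []
    restrict-All p (_∷_ {x = y} x≢y r) with T? (S y)
    ... | yes _ = (λ eq → x≢y (cong proj₁ eq)) ∷ restrict-All p r
    ... | no  _ = restrict-All p r

  restrict-unique : ∀ {xs} → Unique xs → Unique (restrict xs)
  restrict-unique [] = []
  restrict-unique (_∷_ {x = x} x∉ u) with T? (S x)
  ... | yes p = restrict-All p x∉ ∷ restrict-unique u
  ... | no  _ = restrict-unique u

  restrict-≟ : DecidableEquality A → DecidableEquality (Σ A (T ∘ S))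
  restrict-≟ _≟_ u v = map′ Σ-≡ (cong proj₁) (proj₁ u ≟ proj₁ v)

infix 8 _[_]
_[_] : (G : Graph) → Subset G → Graph
G [ M ] = record
  { V        = Σ V (T ∘ M)
  ; _≟_      = restrict-≟ M _≟_
  ; vertices = restrict M vertices
  ; complete = λ u → restrict-complete M u (complete (proj₁ u))
  ; unique   = restrict-unique M unique
  ; _~_      = λ u v → proj₁ u ~ proj₁ v
  ; _~?_     = λ u v → proj₁ u ~? proj₁ v
  ; ~-sym    = ~-sym
  ; ~-irrefl = ~-irrefl
  }
  where open Graph G

AdjacentTo : (G : Graph) → Subset G → Pred (Graph.V G) 0ℓ
AdjacentTo G M v = ∀ m → elems M m → Graph._~_ G v m

AdjacentTo? : ∀ G M → Decidable (AdjacentTo G M)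
AdjacentTo? G M v = ∀? λ m → T? (M m) →-dec (v ~? m)
  where open Graph G

replace : (G : Graph) → Subset G → Graph → Graph
replace G M H = record
  { V        = V
  ; _≟_      = _≟_
  ; vertices = map inj₁ (restrict (not ∘ M) G.vertices) ++ map inj₂ H.vertices
  ; complete = λ where
      (inj₁ u) → ∈-++⁺ˡ (∈-map⁺ inj₁ (restrict-complete (not ∘ M) u (G.complete (proj₁ u))))
      (inj₂ h) → ∈-++⁺ʳ _ (∈-map⁺ inj₂ (H.complete h))
  ; unique   = Unique.++⁺ (Unique.map⁺ inj₁-injective (restrict-unique (not ∘ M) G.unique))
                          (Unique.map⁺ inj₂-injective H.unique)
                          disjoint
  ; _~_      = _~_
  ; _~?_     = _~?_
  ; ~-sym    = λ {u} {v} → ~-sym u v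
  ; ~-irrefl = λ {v} → ~-irrefl v
  }
  where
  module G = Graph G
  module H = Graph H

  V : Set
  V = Σ G.V (T ∘ not ∘ M) ⊎ H.V

  _≟_ : DecidableEquality V
  inj₁ u ≟ inj₁ v = map′ (cong inj₁) inj₁-injective (restrict-≟ (not ∘ M) G._≟_ u v)
  inj₁ _ ≟ inj₂ _ = no λ ()
  inj₂ _ ≟ inj₁ _ = no λ ()
  inj₂ g ≟ inj₂ h = map′ (cong inj₂) inj₂-injective (g H.≟ h)

  disjoint : ∀ {v} {xs ys} → ¬ (v ∈ map inj₁ xs × v ∈ map inj₂ ys)
  disjoint (i , j) with ∈-map⁻ inj₁ i | ∈-map⁻ inj₂ j
  ... | _ , _ , refl | _ , _ , ()

  _~_ : Rel V 0ℓ
  inj₁ (u , _) ~ inj₁ (v , _) = u G.~ v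
  inj₁ (u , _) ~ inj₂ _       = AdjacentTo G M u
  inj₂ _       ~ inj₁ (v , _) = AdjacentTo G M v
  inj₂ g       ~ inj₂ h       = g H.~ h

  _~?_ : B.Decidable _~_
  inj₁ (u , _) ~? inj₁ (v , _) = u G.~? v
  inj₁ (u , _) ~? inj₂ _       = AdjacentTo? G M u
  inj₂ _       ~? inj₁ (v , _) = AdjacentTo? G M v
  inj₂ g       ~? inj₂ h       = g H.~? h

  ~-sym : ∀ u v → u ~ v → v ~ u
  ~-sym (inj₁ _) (inj₁ _) = G.~-sym
  ~-sym (inj₁ _) (inj₂ _) = id
  ~-sym (inj₂ _) (inj₁ _) = id
  ~-sym (inj₂ _) (inj₂ _) = H.~-sym

  ~-irrefl : ∀ v → ¬ (v ~ v)
  ~-irrefl (inj₁ _) = G.~-irrefl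
  ~-irrefl (inj₂ _) = H.~-irrefl

path : ℕ → Graph
path n = record
  { V        = Fin n
  ; _≟_      = Fin._≟_
  ; vertices = allFin n
  ; complete = ∈-allFin
  ; unique   = Unique.allFin⁺ n
  ; _~_      = λ i j → suc (toℕ i) ≡ toℕ j ⊎ suc (toℕ j) ≡ toℕ i
  ; _~?_     = λ i j → (suc (toℕ i) ℕ.≟ toℕ j) ⊎-dec (suc (toℕ j) ℕ.≟ toℕ i)
  ; ~-sym    = Sum.swap
  ; ~-irrefl = Sum.[ ℕ.1+n≢n , ℕ.1+n≢n ]
  }

edgeless : ℕ → Graph
edgeless n = record
  { V        = Fin n
  ; _≟_      = Fin._≟_
  ; vertices = allFin n
  ; complete = ∈-allFin
  ; unique   = Unique.allFin⁺ n
  ; _~_      = λ _ _ → ⊥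
  ; _~?_     = λ _ _ → no id
  ; ~-sym    = id
  ; ~-irrefl = id
  }

------------------------------------------------------------------------
-- The Maker-Breaker domination game

data Player : Set where
  dominator staller : Player

opponent : Player → Player
opponent dominator = staller
opponent staller   = dominator

_≟ᴾ_ : DecidableEquality Player
dominator ≟ᴾ dominator = yes refl
dominator ≟ᴾ staller   = no λ ()
staller   ≟ᴾ dominator = no λ ()
staller   ≟ᴾ staller   = yes refl

data Outcome : Set where
  𝒟 𝒮 𝒩 : Outcome

module Game (G : Graph) where
  open Graph G

  -- `nothing` marks an unclaimed vertex.
  Position : Set
  Position = V → Maybe Player

  start : Position
  start _ = nothing

  claim : Position → V → Player → Position
  claim p v P w with w ≟ v
  ... | yes _ = just P
  ... | no  _ = p w

  Unclaimed : Position → Pred V 0ℓ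
  Unclaimed p v = p v ≡ nothing

  Full : Position → Set
  Full p = ∀ v → ¬ Unclaimed p v

  ClaimedBy : Player → Position → Pred V 0ℓ
  ClaimedBy P p v = p v ≡ just P

  Won : Player → Position → Set
  Won dominator p = Σ[ S ∈ Subset G ] IsDominating G (elems S) × elems S ⊆ ClaimedBy dominator p
  Won staller   p = ¬ Won dominator p

  -- Winning strategies for player P from a given position, as finite game
  -- trees: the tree fixes one move whenever P is to move and has a branch for
  -- each legal move of the opponent.  The winner is read off once every vertex
  -- has been claimed.
  mutual
    data WinsMoving (P : Player) (p : Position) : Set where
      over : Full p → Won P p → WinsMoving P p
      move : ∀ v → Unclaimed p v → WinsWaiting P (claim p v P) → WinsMoving P p

    data WinsWaiting (P : Player) (p : Position) : Set where
      over  : Full p → Won P p → WinsWaiting P p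
      reply : ¬ Full p → (∀ v → Unclaimed p v → WinsMoving P (claim p v (opponent P))) →
              WinsWaiting P p

  WinsFirst WinsSecond : Player → Set
  WinsFirst  P = WinsMoving  P start
  WinsSecond P = WinsWaiting P start

  HasOutcome : Outcome → Set
  HasOutcome 𝒟 = WinsFirst dominator × WinsSecond dominator
  HasOutcome 𝒮 = WinsFirst staller × WinsSecond staller
  HasOutcome 𝒩 = WinsFirst dominator × WinsFirst staller

  ----------------------------------------------------------------------
  -- Every graph has exactly one outcome

  Unclaimed? : ∀ p → Decidable (Unclaimed p)
  Unclaimed? p v with p v
  ... | nothing = yes refl
  ... | just _  = no λ ()

  full? : ∀ p → Full p ⊎ ∃ (Unclaimed p)
  full? p with ∃? (Unclaimed? p)
  ... | yes e = inj₂ e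
  ... | no ¬e = inj₁ λ v q → ¬e (v , q)

  claim-same : ∀ p v P → claim p v P v ≡ just P
  claim-same p v P with v ≟ v
  ... | yes _  = refl
  ... | no v≢v = contradiction refl v≢v

  claim-other : ∀ p {v w} P → w ≢ v → claim p v P w ≡ p w
  claim-other p {v} {w} P w≢v with w ≟ v
  ... | yes w≡v = contradiction w≡v w≢v
  ... | no  _   = refl

  claim-unclaimed : ∀ p v P → Unclaimed (claim p v P) ⊆ Unclaimed p
  claim-unclaimed p v P {w} q with w ≟ v
  claim-unclaimed p v P {w} () | yes _
  ... | no _ = q

  won? : ∀ p → Won dominator p ⊎ Won staller p
  won? p with ∀? (λ x → ∃? (λ y → N[ x ]? y ×-dec claimed? y))
    where
    claimed? : Decidable (ClaimedBy dominator p)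
    claimed? v = ≡-dec _≟ᴾ_ (p v) (just dominator)
  ... | yes dom = inj₁ (S , (λ x → let (y , n , c) = dom x in y , n , fromWitness c) , toWitness)
    where
    S : Subset G
    S v = isYes (≡-dec _≟ᴾ_ (p v) (just dominator))
  ... | no ¬dom = inj₂ λ (S , dom , S⊆) → ¬dom λ x → let (y , n , s) = dom x in y , n , S⊆ s

  #unclaimed : Position → ℕ
  #unclaimed p = length (filter (Unclaimed? p) vertices)

  claim-decreases : ∀ p {v} P → Unclaimed p v → #unclaimed (claim p v P) < #unclaimed p
  claim-decreases p {v} P u = strict (complete v)
    where
    # : Position → List V → ℕ
    # q xs = length (filter (Unclaimed? q) xs)

    weak : ∀ xs → # (claim p v P) xs ≤ # p xs
    weak [] = z≤n
    weak (x ∷ xs) with Unclaimed? (claim p v P) x | Unclaimed? p x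
    ... | yes _ | yes _ = s≤s (weak xs)
    ... | yes a | no ¬b = contradiction (claim-unclaimed p v P a) ¬b
    ... | no _  | yes _ = ℕ.m≤n⇒m≤1+n (weak xs)
    ... | no _  | no _  = weak xs

    strict : ∀ {xs} → v ∈ xs → # (claim p v P) xs < # p xs
    strict {x ∷ xs} (here refl) with Unclaimed? (claim p v P) x | Unclaimed? p x
    ... | yes a | _     = contradiction (trans (sym (claim-same p v P)) a) λ ()
    ... | no _  | yes _ = s≤s (weak xs)
    ... | no _  | no ¬u = contradiction u ¬u
    strict {x ∷ xs} (there i) with Unclaimed? (claim p v P) x | Unclaimed? p x
    ... | yes _ | yes _ = s≤s (strict i)
    ... | yes a | no ¬b = contradiction (claim-unclaimed p v P a) ¬b
    ... | no _  | yes _ = ℕ.m≤n⇒m≤1+n (strict i)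
    ... | no _  | no _  = strict i

  won-or-lost : ∀ P p → Won P p ⊎ Won (opponent P) p
  won-or-lost dominator p = won? p
  won-or-lost staller   p = Sum.swap (won? p)

  won-exclusive : ∀ P p → Won P p → ¬ Won (opponent P) p
  won-exclusive dominator p w l = l w
  won-exclusive staller   p w l = w l

  choose : ∀ {A B : Pred V 0ℓ} p → (∀ v → Unclaimed p v → A v ⊎ B v) →
           (∃[ v ] Unclaimed p v × A v) ⊎ (∀ v → Unclaimed p v → B v)
  choose {A} {B} p f = Sum.map₂ (λ g v → g (complete v)) (go vertices)
    where
    go : ∀ xs → (∃[ v ] Unclaimed p v × A v) ⊎ (∀ {v} → v ∈ xs → Unclaimed p v → B v)
    go [] = inj₂ λ ()
    go (x ∷ xs) with go xs
    ... | inj₁ e = inj₁ e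
    ... | inj₂ g with Unclaimed? p x
    ...   | no ¬u = inj₂ λ where
      (here refl) u → contradiction u ¬u
      (there i)   u → g i u
    ...   | yes u with f x u
    ...     | inj₁ a = inj₁ (x , u , a)
    ...     | inj₂ b = inj₂ λ where
      (here refl) _ → b
      (there i)   u → g i u

  determined : ∀ P p → WinsMoving P p ⊎ WinsWaiting (opponent P) p
  determined P p = go (#unclaimed p) P p ℕ.≤-refl
    where
    waiting : ∀ P {p} → WinsWaiting (opponent (opponent P)) p → WinsWaiting P p
    waiting dominator w = w
    waiting staller   w = w

    moving : ∀ P {p v} → WinsMoving (opponent P) (claim p v P) →
             WinsMoving (opponent P) (claim p v (opponent (opponent P)))
    moving dominator w = w
    moving staller   w = w

    go : ∀ n P p → #unclaimed p ≤ n → WinsMoving P p ⊎ WinsWaiting (opponent P) p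
    go n P p ≤n with full? p
    go n P p ≤n | inj₁ full = Sum.map (over full) (over full) (won-or-lost P p)
    go 0 P p ≤n | inj₂ (v , u) = contradiction (ℕ.<-≤-trans (claim-decreases p P u) ≤n) λ ()
    go (suc n) P p ≤n | inj₂ (v , u)
      with choose p (λ w uw → Sum.swap (go n (opponent P) (claim p w P)
                      (ℕ.≤-pred (ℕ.≤-trans (claim-decreases p P uw) ≤n))))
    ... | inj₁ (w , uw , s) = inj₁ (move w uw (waiting P s))
    ... | inj₂ s            = inj₂ (reply (λ full → full v u) (λ w uw → moving P (s w uw)))

  exclusive : ∀ P {p} → WinsMoving P p → ¬ WinsWaiting (opponent P) p
  exclusive P         (over _ w)    (over _ l)   = won-exclusive P _ w l
  exclusive P         (over f w)    (reply ¬f _) = ¬f f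
  exclusive P         (move v u s)  (over f _)   = f v u
  exclusive dominator (move v u s)  (reply _ r)  = exclusive staller   (r v u) s
  exclusive staller   (move v u s)  (reply _ r)  = exclusive dominator (r v u) s

  -- p ≼ q : position q is at least as good for Dominator as p.
  infix 4 _≼_
  _≼_ : Position → Position → Set
  p ≼ q = ∀ v → (p v ≡ just dominator → q v ≡ just dominator)
              × (q v ≡ just staller → p v ≡ just staller)

  ≼-won : ∀ {p q} → p ≼ q → Won dominator p → Won dominator q
  ≼-won p≼q (S , dom , S⊆) = S , dom , λ {v} s → proj₁ (p≼q v) (S⊆ s)

  ≼-claimˡ : ∀ {p q} v → p ≼ q → claim p v staller ≼ q
  ≼-claimˡ v p≼q w with w ≟ v
  ... | yes _ = (λ ()) , λ _ → refl
  ... | no  _ = p≼q w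

  ≼-claimʳ : ∀ {p q} v → p ≼ q → p ≼ claim q v dominator
  ≼-claimʳ v p≼q w with w ≟ v
  ... | yes _ = (λ _ → refl) , λ ()
  ... | no  _ = p≼q w

  ≼-claim : ∀ {p q} v P → p ≼ q → claim p v P ≼ claim q v P
  ≼-claim v P p≼q w with w ≟ v
  ... | yes _ = id , id
  ... | no  _ = p≼q w

  ≼-claim-dominator : ∀ {p q} v → q v ≡ just dominator → p ≼ q → claim p v dominator ≼ q
  ≼-claim-dominator v d p≼q w with w ≟ v
  ... | yes refl = (λ _ → d) , λ s → contradiction (trans (sym d) s) λ ()
  ... | no  _    = p≼q w

  ≼-claim-staller : ∀ {p q} v → p v ≡ just staller → p ≼ q → p ≼ claim q v staller
  ≼-claim-staller v s p≼q w with w ≟ v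
  ... | yes refl = (λ d → contradiction (trans (sym s) d) λ ()) , λ _ → s
  ... | no  _    = p≼q w

  mutual
    ≼-full-moving : ∀ {p q} → p ≼ q → Full q → WinsMoving dominator p → Won dominator q
    ≼-full-moving p≼q full (over _ w) = ≼-won p≼q w
    ≼-full-moving {q = q} p≼q full (move v u s) with q v in eq
    ... | just dominator = ≼-full-waiting (≼-claim-dominator v eq p≼q) full s
    ... | just staller   = contradiction (trans (sym u) (proj₂ (p≼q v) eq)) λ ()
    ... | nothing        = contradiction eq (full v)

    ≼-full-waiting : ∀ {p q} → p ≼ q → Full q → WinsWaiting dominator p → Won dominator q
    ≼-full-waiting p≼q full (over _ w) = ≼-won p≼q w
    ≼-full-waiting {p} p≼q full (reply ¬f r) with full? p
    ... | inj₁ f       = contradiction f ¬f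
    ... | inj₂ (v , u) = ≼-full-moving (≼-claimˡ v p≼q) full (r v u)

  won-keeps : ∀ {p v} P → Unclaimed p v → Won dominator p → Won dominator (claim p v P)
  won-keeps {p} {v} P u (S , dom , S⊆) = S , dom , λ {w} s → keeps w (S⊆ s)
    where
    keeps : ∀ w → ClaimedBy dominator p w → ClaimedBy dominator (claim p v P) w
    keeps w d with w ≟ v
    ... | yes refl = contradiction (trans (sym u) d) λ ()
    ... | no  _    = d

  won⇒wins : ∀ {p} → Won dominator p → WinsMoving dominator p × WinsWaiting dominator p
  won⇒wins {p} = go (#unclaimed p) p ℕ.≤-refl
    where
    go : ∀ n p → #unclaimed p ≤ n → Won dominator p → WinsMoving dominator p × WinsWaiting dominator p
    go n p ≤n won with full? p
    ... | inj₁ full = over full won , over full won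
    go 0 p ≤n won | inj₂ (v , u) = contradiction (ℕ.<-≤-trans (claim-decreases p staller u) ≤n) λ ()
    go (suc n) p ≤n won | inj₂ (v , u) =
      move v u (proj₂ (next dominator u)) , reply (λ full → full v u) (λ w uw → proj₁ (next staller uw))
      where
      next : ∀ P {w} → Unclaimed p w → WinsMoving dominator (claim p w P) × WinsWaiting dominator (claim p w P)
      next P {w} uw = go n (claim p w P) (ℕ.≤-pred (ℕ.≤-trans (claim-decreases p P uw) ≤n)) (won-keeps P uw won)

  mutual
    ≼-moving : ∀ {p q} → p ≼ q → WinsMoving dominator p → WinsMoving dominator q
    ≼-moving p≼q (over _ w) = proj₁ (won⇒wins (≼-won p≼q w))
    ≼-moving {q = q} p≼q (move v u s) with q v in eq
    ... | nothing      = move v eq (≼-waiting (≼-claim v dominator p≼q) s)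
    ... | just staller = contradiction (trans (sym u) (proj₂ (p≼q v) eq)) λ ()
    ... | just dominator with full? q
    ...   | inj₁ full     = over full (≼-full-moving p≼q full (move v u s))
    ...   | inj₂ (w , uw) = move w uw (≼-waiting (≼-claimʳ w (≼-claim-dominator v eq p≼q)) s)

    ≼-waiting : ∀ {p q} → p ≼ q → WinsWaiting dominator p → WinsWaiting dominator q
    ≼-waiting p≼q (over _ w) = proj₂ (won⇒wins (≼-won p≼q w))
    ≼-waiting {p} {q} p≼q (reply ¬f r) with full? q
    ... | inj₁ full    = over full (≼-full-waiting p≼q full (reply ¬f r))
    ... | inj₂ (w , u) = reply (λ full → full w u) answer
      where
      answer : ∀ v → Unclaimed q v → WinsMoving dominator (claim q v staller)
      answer v uv with p v in eq
      ... | nothing        = ≼-moving (≼-claim v staller p≼q) (r v eq)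
      ... | just dominator = contradiction (trans (sym uv) (proj₁ (p≼q v) eq)) λ ()
      ... | just staller with full? p
      ...   | inj₁ full      = contradiction full ¬f
      ...   | inj₂ (w′ , u′) = ≼-moving (≼-claimˡ w′ (≼-claim-staller v eq p≼q)) (r w′ u′)

  second⇒first : WinsSecond dominator → WinsFirst dominator
  second⇒first s with full? start
  ... | inj₁ full    = over full (≼-full-waiting (λ _ → id , id) full s)
  ... | inj₂ (v , u) = move v u (≼-waiting (≼-claimʳ v λ w → id , id) s)

  hasOutcome : ∃ HasOutcome
  hasOutcome with determined dominator start | determined staller start
  ... | inj₁ d₁ | inj₁ s₁ = 𝒩 , d₁ , s₁
  ... | inj₁ d₁ | inj₂ d₂ = 𝒟 , d₁ , d₂
  ... | inj₂ s₂ | inj₁ s₁ = 𝒮 , s₁ , s₂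
  ... | inj₂ s₂ | inj₂ d₂ = contradiction s₂ (exclusive dominator (second⇒first d₂))

  hasOutcome-unique : ∀ {o o′} → HasOutcome o → HasOutcome o′ → o ≡ o′
  hasOutcome-unique {𝒟} {𝒟} _         _         = refl
  hasOutcome-unique {𝒟} {𝒮} (d₁ , _)  (_ , s₂)  = contradiction s₂ (exclusive dominator d₁)
  hasOutcome-unique {𝒟} {𝒩} (_ , d₂)  (_ , s₁)  = contradiction d₂ (exclusive staller s₁)
  hasOutcome-unique {𝒮} {𝒟} (_ , s₂)  (d₁ , _)  = contradiction s₂ (exclusive dominator d₁)
  hasOutcome-unique {𝒮} {𝒮} _         _         = refl
  hasOutcome-unique {𝒮} {𝒩} (_ , s₂)  (d₁ , _)  = contradiction s₂ (exclusive dominator d₁)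
  hasOutcome-unique {𝒩} {𝒟} (_ , s₁)  (_ , d₂)  = contradiction d₂ (exclusive staller s₁)
  hasOutcome-unique {𝒩} {𝒮} (d₁ , _)  (_ , s₂)  = contradiction s₂ (exclusive dominator d₁)
  hasOutcome-unique {𝒩} {𝒩} _         _         = refl

outcome : Graph → Outcome
outcome G = proj₁ (Game.hasOutcome G)

outcome-correct : ∀ G → Game.HasOutcome G (outcome G)
outcome-correct G = proj₂ (Game.hasOutcome G)

gadget : Outcome → Graph
gadget 𝒟 = path 2
gadget 𝒮 = edgeless 2
gadget 𝒩 = path 3

{-# OPTIONS --safe #-}

-- The module is felt only through the question who wins on it.  It is large
-- enough for Dominator always to claim one of its vertices, which dominates the
-- vertices adjacent to M; and some vertex of it is undominated from within
-- exactly when Staller wins on it.  So replace G M H is equivalent to a game in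
-- which H is shrunk to a single vertex m, the vertices adjacent to M count as
-- dominated, and m is already claimed by the winner on H, or is free if the
-- first player wins on H.  This game depends on H through its outcome only.
module Submission where

open import Data.Bool.Base using (true; false; not; T)
open import Data.Bool.Properties using (T?; T-irrelevant)
open import Data.Fin.Patterns using (0F; 1F)
open import Data.List.Base using (List; []; _∷_; length; filterᵇ)
open import Data.List.Properties using (filter-accept; filter-reject)
open import Data.List.Relation.Unary.All using ([]; _∷_)
open import Data.List.Relation.Unary.AllPairs using ([]; _∷_)
open import Data.List.Relation.Unary.Unique.Propositional using (Unique)
open import Data.Maybe.Base using (Maybe; just; nothing)
open import Data.Maybe.Properties using (≡-dec)
open import Data.Nat.Base using (ℕ; suc; _≤_; z≤n; s≤s)
import Data.Nat.Properties as ℕ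
open import Data.Product.Base using (_×_; _,_; proj₁; proj₂; ∃-syntax; Σ-syntax)
open import Data.Sum.Base using (_⊎_; inj₁; inj₂; [_,_])
open import Data.Sum.Properties using (inj₁-injective; inj₂-injective)
open import Function.Base using (_∘_; id)
open import Function.Definitions using (Injective; StrictlySurjective)
open import Relation.Binary.PropositionalEquality
  using (_≡_; _≢_; _≗_; refl; sym; trans; cong; subst)
open import Relation.Nullary.Decidable using (yes; no; isYes; toWitness; fromWitness)
open import Relation.Nullary.Negation using (¬_; contradiction)
open import Defs

-- Extra moves and strategies that preserve an invariant.

opponent-involutive : ∀ P → opponent (opponent P) ≡ P
opponent-involutive dominator = refl
opponent-involutive staller   = refl

module _ (G : Graph) where
  open Graph G
  open Game G

  Dominated : Position → Set
  Dominated p = ∀ x → ∃[ y ] N[ x ] y × p y ≡ just dominator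

  won⇒dominated : ∀ {p} → Won dominator p → Dominated p
  won⇒dominated (_ , dom , S⊆) x = let (y , n , s) = dom x in y , n , S⊆ s

  dominated⇒won : ∀ {p} → Dominated p → Won dominator p
  dominated⇒won {p} dom = S , (λ x → let (y , n , c) = dom x in y , n , fromWitness c) , toWitness
    where
    S : Subset G
    S v = isYes (≡-dec _≟ᴾ_ (p v) (just dominator))

  -- Having the move never hurts. For Dominator this is monotonicity under `≼`, after claiming any
  -- free vertex. For Staller it follows by determinacy: otherwise Dominator would win waiting,
  -- hence also moving, against Staller's win.
  waiting⇒moving : ∀ P {p} → WinsWaiting P p → WinsMoving P p
  waiting⇒moving dominator {p} s with full? p
  ... | inj₁ full    = over full (≼-full-waiting (λ _ → id , id) full s)
  ... | inj₂ (v , u) = move v u (≼-waiting (≼-claimʳ v λ _ → id , id) s)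
  waiting⇒moving staller {p} s with determined staller p
  ... | inj₁ m = m
  ... | inj₂ d = contradiction s (exclusive dominator (waiting⇒moving dominator d))

  -- P may also decline to answer, since an extra move never hurts.
  Answer : Player → (Position → Set) → Position → Set
  Answer P I p = I p ⊎ ∃[ w ] Unclaimed p w × I (claim p w P)

  -- `I` speaks of positions in which the opponent of `P` is to move. If `P` can restore it after
  -- each such move, induction on the number of unclaimed vertices gives a strategy; `final` reads
  -- off the winner.
  module Invariant (P : Player) (I : Position → Set)
    (final : ∀ {p} → I p → Full p → Won P p)
    (step  : ∀ {p} v → I p → Unclaimed p v → Answer P I (claim p v (opponent P)))
    where

    invariant⇒waiting : ∀ {p} → I p → WinsWaiting P p
    invariant⇒waiting {p} = go (#unclaimed p) ℕ.≤-refl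
      where
      go : ∀ n {p} → #unclaimed p ≤ n → I p → WinsWaiting P p
      go n {p} ≤n i with full? p
      go n ≤n i | inj₁ full = over full (final i full)
      go 0 {p} ≤n i | inj₂ (v , u) = contradiction (ℕ.<-≤-trans (claim-decreases p P u) ≤n) λ ()
      go (suc n) {p} ≤n i | inj₂ (v , u) = reply (λ full → full v u) answer
        where
        answer : ∀ v → Unclaimed p v → WinsMoving P (claim p v (opponent P))
        answer v u with step v i u | ℕ.≤-pred (ℕ.≤-trans (claim-decreases p (opponent P) u) ≤n)
        ... | inj₁ i′            | ≤n′ = waiting⇒moving P (go n ≤n′ i′)
        ... | inj₂ (w , uw , i′) | ≤n′ =
          move w uw (go n (ℕ.≤-trans (ℕ.<⇒≤ (claim-decreases _ P uw)) ≤n′) i′)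

    answer⇒moving : ∀ {p} → Answer P I p → WinsMoving P p
    answer⇒moving (inj₁ i)           = waiting⇒moving P (invariant⇒waiting i)
    answer⇒moving (inj₂ (w , u , i)) = move w u (invariant⇒waiting i)

  full-waiting : ∀ {P p} → Full p → WinsWaiting P p → Won P p
  full-waiting _    (over _ w)   = w
  full-waiting full (reply ¬f _) = contradiction full ¬f

-- Transfer of outcomes between graphs; invariance under isomorphism.

module _ (G₁ G₂ : Graph) where
  private
    module 𝔾₁ = Game G₁
    module 𝔾₂ = Game G₂

  claim-cong : ∀ {p q v w v′ w′} P → (w ≡ v → w′ ≡ v′) → (w′ ≡ v′ → w ≡ v) → p w ≡ q w′ →
               𝔾₁.claim p v P w ≡ 𝔾₂.claim q v′ P w′
  claim-cong {v = v} {w} {v′} {w′} P to from eq with Graph._≟_ G₁ w v | Graph._≟_ G₂ w′ v′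
  ... | yes _ | yes _ = refl
  ... | yes e | no ¬e = contradiction (to e) ¬e
  ... | no ¬e | yes e = contradiction (from e) ¬e
  ... | no _  | no _  = eq

  -- One direction is enough: the outcome of `G₁` carries over to `G₂`, and `G₂` has only one.
  outcome-≡ : (∀ P → 𝔾₁.WinsFirst P → 𝔾₂.WinsFirst P) →
              (∀ P → 𝔾₁.WinsSecond P → 𝔾₂.WinsSecond P) → outcome G₁ ≡ outcome G₂
  outcome-≡ first second =
    𝔾₂.hasOutcome-unique (transfer (outcome G₁) (outcome-correct G₁)) (outcome-correct G₂)
    where
    transfer : ∀ o → 𝔾₁.HasOutcome o → 𝔾₂.HasOutcome o
    transfer 𝒟 (f , s)  = first dominator f , second dominator s
    transfer 𝒮 (f , s)  = first staller f , second staller s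
    transfer 𝒩 (f , f′) = first dominator f , first staller f′

module Isomorphism (G₁ G₂ : Graph) (f : Graph.V G₁ → Graph.V G₂)
  (injective  : Injective _≡_ _≡_ f)
  (surjective : StrictlySurjective _≡_ f)
  (preserves  : ∀ {u v} → Graph._~_ G₁ u v → Graph._~_ G₂ (f u) (f v))
  (reflects   : ∀ {u v} → Graph._~_ G₂ (f u) (f v) → Graph._~_ G₁ u v)
  where
  private
    module 𝔾₁ = Game G₁
    module 𝔾₂ = Game G₂

    -- The position `q` is carried along instead of being `p ∘ f`, since claiming commutes with `f`
    -- only pointwise and functions are not extensional here.
    I : Player → 𝔾₂.Position → Set
    I P p = ∃[ q ] (q ≗ p ∘ f) × 𝔾₁.WinsWaiting P q

    claim-∘ : ∀ {p q} v P → q ≗ p ∘ f → 𝔾₁.claim q v P ≗ 𝔾₂.claim p (f v) P ∘ f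
    claim-∘ v P eq w = claim-cong G₁ G₂ P (cong f) injective (eq w)

    won : ∀ P {p q} → q ≗ p ∘ f → 𝔾₁.Won P q → 𝔾₂.Won P p
    won dominator {p} eq w = dominated⇒won G₂ dom
      where
      dom : Dominated G₂ p
      dom x with surjective x
      ... | x′ , refl with won⇒dominated G₁ w x′
      ...   | y , inj₁ refl , c = f y , inj₁ refl , trans (sym (eq y)) c
      ...   | y , inj₂ x~y  , c = f y , inj₂ (preserves x~y) , trans (sym (eq y)) c
    won staller {p} {q} eq l w = l (dominated⇒won G₁ dom)
      where
      dom : Dominated G₁ q
      dom x with won⇒dominated G₂ w (f x)
      ... | y , n , c with surjective y
      dom x | _ , inj₁ e   , c | y , refl = y , inj₁ (injective e) , trans (eq y) c
      dom x | _ , inj₂ x~y , c | y , refl = y , inj₂ (reflects x~y) , trans (eq y) c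

    respond : ∀ P {p q} → q ≗ p ∘ f → 𝔾₁.WinsMoving P q → Answer G₂ P (I P) p
    respond P eq (𝔾₁.over full w) = inj₁ (_ , eq , 𝔾₁.over full w)
    respond P eq (𝔾₁.move v u s)  =
      inj₂ (f v , trans (sym (eq v)) u , _ , claim-∘ v P eq , s)

    final : ∀ P {p} → I P p → 𝔾₂.Full p → 𝔾₂.Won P p
    final P (q , eq , s) full =
      won P eq (full-waiting G₁ (λ v u → full (f v) (trans (sym (eq v)) u)) s)

    step : ∀ P {p} v → I P p → 𝔾₂.Unclaimed p v → Answer G₂ P (I P) (𝔾₂.claim p v (opponent P))
    step P v (q , eq , s) u with surjective v
    step P v (q , eq , 𝔾₁.over full _) u | v′ , refl = contradiction (trans (eq v′) u) (full v′)
    step P v (q , eq , 𝔾₁.reply _ r) u | v′ , refl =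
      respond P (claim-∘ v′ (opponent P) eq) (r v′ (trans (eq v′) u))

  outcome-iso : outcome G₁ ≡ outcome G₂
  outcome-iso = outcome-≡ G₁ G₂
    (λ P m → Invariant.answer⇒moving G₂ P (I P) (final P) (step P) (respond P (λ _ → refl) m))
    (λ P s → Invariant.invariant⇒waiting G₂ P (I P) (final P) (step P) (_ , (λ _ → refl) , s))

-- Replacing a module by the subgraph that it induces.

module _ (G : Graph) (M : Subset G) where
  open Graph G

  replace-self : IsModule G M → outcome (replace G M (G [ M ])) ≡ outcome G
  replace-self isModule =
    Isomorphism.outcome-iso C G f
      (λ {u} {v} → injective u v) surjective (λ {u} {v} → preserves u v) (λ {u} {v} → reflects u v)
    where
    C : Graph
    C = replace G M (G [ M ])

    f : Graph.V C → V
    f = [ proj₁ , proj₁ ]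

    outside : ∀ {v} → T (not (M v)) → ¬ T (M v)
    outside {v} with M v
    ... | true  = λ ()
    ... | false = λ _ ()

    injective : ∀ u v → f u ≡ f v → u ≡ v
    injective (inj₁ (a , p)) (inj₁ (_ , q)) refl = cong (λ r → inj₁ (a , r)) (T-irrelevant p q)
    injective (inj₁ (_ , p)) (inj₂ (_ , q)) refl = contradiction q (outside p)
    injective (inj₂ (_ , p)) (inj₁ (_ , q)) refl = contradiction p (outside q)
    injective (inj₂ (a , p)) (inj₂ (_ , q)) refl = cong (λ r → inj₂ (a , r)) (T-irrelevant p q)

    surjective : StrictlySurjective _≡_ f
    surjective v with T? (M v) | T? (not (M v))
    ... | yes p | _     = inj₂ (v , p) , refl
    ... | no _  | yes q = inj₁ (v , q) , refl
    ... | no ¬p | no ¬q with M v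
    ...   | true  = contradiction _ ¬p
    ...   | false = contradiction _ ¬q

    -- The module property enters here: `u` lies in the closed neighborhood of `m` outside `M`,
    -- hence in that of `m′`, and it cannot be `m′` itself.
    adjacent : ∀ {u m} → T (not (M u)) → T (M m) → u ~ m → AdjacentTo G M u
    adjacent {u} {m} u∉M m∈M u~m m′ m′∈M
      with proj₁ (proj₁ (isModule m m′ m∈M m′∈M) (inj₂ (~-sym u~m) , outside u∉M))
    ... | inj₁ refl = contradiction m′∈M (outside u∉M)
    ... | inj₂ m′~u = ~-sym m′~u

    preserves : ∀ u v → Graph._~_ C u v → f u ~ f v
    preserves (inj₁ _)       (inj₁ _)       e = e
    preserves (inj₁ _)       (inj₂ (v , q)) e = e v q
    preserves (inj₂ (u , p)) (inj₁ _)       e = ~-sym (e u p)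
    preserves (inj₂ _)       (inj₂ _)       e = e

    reflects : ∀ u v → f u ~ f v → Graph._~_ C u v
    reflects (inj₁ _)       (inj₁ _)       e = e
    reflects (inj₁ (_ , p)) (inj₂ (_ , q)) e = adjacent p q e
    reflects (inj₂ (_ , p)) (inj₁ (_ , q)) e = adjacent q p (~-sym e)
    reflects (inj₂ _)       (inj₂ _)       e = e

-- Orders of graphs and the existence of distinct vertices.

order : Graph → ℕ
order H = length (Graph.vertices H)

order-induced : ∀ G M → order (G [ M ]) ≡ card G M
order-induced G M = go (Graph.vertices G)
  where
  go : ∀ xs → length (restrict M xs) ≡ length (filterᵇ M xs)
  go [] = refl
  go (x ∷ xs) with T? (M x)
  ... | yes x∈M = trans (cong suc (go xs)) (cong length (sym (filter-accept (T? ∘ M) x∈M)))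
  ... | no x∉M  = trans (go xs) (cong length (sym (filter-reject (T? ∘ M) x∉M)))

module _ (H : Graph) where
  open Graph H

  distinct-pair : 2 ≤ order H → Σ[ a ∈ V ] Σ[ b ∈ V ] a ≢ b
  distinct-pair = go unique
    where
    go : {xs : List V} → Unique xs → 2 ≤ length xs → Σ[ a ∈ V ] Σ[ b ∈ V ] a ≢ b
    go {a ∷ b ∷ _} ((a≢b ∷ _) ∷ _) _ = a , b , a≢b
    go {_ ∷ []}    _               (s≤s ())

  -- Of three distinct vertices at most one is `h`. The pair is a reserve for a player whose
  -- opponent opens the play in `H` at `h`.
  distinct-pair-avoiding : 3 ≤ order H → (h : V) → ∃[ a ] ∃[ b ] a ≢ b × a ≢ h × b ≢ h
  distinct-pair-avoiding = go unique
    where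
    go : {xs : List V} → Unique xs → 3 ≤ length xs → (h : V) → ∃[ a ] ∃[ b ] a ≢ b × a ≢ h × b ≢ h
    go {_ ∷ []}     _ (s≤s ())
    go {_ ∷ _ ∷ []} _ (s≤s (s≤s ()))
    go {a ∷ b ∷ c ∷ _} ((a≢b ∷ a≢c ∷ _) ∷ (b≢c ∷ _) ∷ _) _ h with a ≟ h | b ≟ h
    ... | yes refl | _        = b , c , b≢c , a≢b ∘ sym , a≢c ∘ sym
    ... | no a≢h   | yes refl = a , c , a≢c , a≢h , b≢c ∘ sym
    ... | no a≢h   | no b≢h   = a , b , a≢b , a≢h , b≢h

-- A player who does not own `m` needs two free vertices of `H` to be sure of one. If `m` starts
-- free, the opponent may take a third vertex first.
minOrder : Outcome → ℕ
minOrder 𝒟 = 2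
minOrder 𝒮 = 2
minOrder 𝒩 = 3

minOrder≥2 : ∀ o → 2 ≤ minOrder o
minOrder≥2 𝒟 = s≤s (s≤s z≤n)
minOrder≥2 𝒮 = s≤s (s≤s z≤n)
minOrder≥2 𝒩 = s≤s (s≤s z≤n)

-- The reduced game and its simulation on `replace G M H`.

module _ (G : Graph) (M : Subset G) where

  -- The vertex m is inj₂ 0F.  Dominator owns inj₂ 1F from the start: this
  -- dominates the vertices adjacent to M.
  reduced : Graph
  reduced = replace G M (edgeless 2)

  private
    module 𝔾R = Game reduced

  ownerOfModule : Outcome → Maybe Player
  ownerOfModule 𝒟 = just dominator
  ownerOfModule 𝒮 = just staller
  ownerOfModule 𝒩 = nothing

  reducedStart : Outcome → 𝔾R.Position
  reducedStart o (inj₁ _)  = nothing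
  reducedStart o (inj₂ 0F) = ownerOfModule o
  reducedStart o (inj₂ 1F) = just dominator

  -- Strategies of both players are carried from the reduced game to `replace G M H`, in this
  -- direction only; determinacy later supplies the other. The vertex `h₀` records that `H` is
  -- nonempty.
  module Simulation (H : Graph) (h₀ : Graph.V H) where
    private
      C : Graph
      C = replace G M H
      module H  = Graph H
      module 𝔾C = Game C
      module 𝔾H = Game H

    -- A reserve: one claim of the opponent cannot take both vertices, so `P` gets one of them by
    -- answering at once.
    TwoUnclaimed : 𝔾H.Position → Set
    TwoUnclaimed r = Σ[ a ∈ H.V ] Σ[ b ∈ H.V ] a ≢ b × 𝔾H.Unclaimed r a × 𝔾H.Unclaimed r b

    -- The index is the owner of m.  When the opponent owns m, P only needs to own
    -- some vertex of H in the end.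
    data Module (P : Player) (r : 𝔾H.Position) : Maybe Player → Set where
      fresh  : (∀ h → 𝔾H.Unclaimed r h) → 𝔾H.WinsFirst P →
               (∀ h → Σ[ a ∈ H.V ] Σ[ b ∈ H.V ] a ≢ b × a ≢ h × b ≢ h) → Module P r nothing
      ahead  : ∀ {r′} → r′ ≗ r → 𝔾H.WinsWaiting P r′ → Module P r (just P)
      behind : (∃[ h ] 𝔾H.ClaimedBy P r h) ⊎ TwoUnclaimed r → Module P r (just (opponent P))

    Module-resp : ∀ {P r r′ s} → r ≗ r′ → Module P r s → Module P r′ s
    Module-resp eq (fresh free m two) = fresh (λ h → trans (sym (eq h)) (free h)) m two
    Module-resp eq (ahead eq′ s)      = ahead (λ h → trans (eq′ h) (eq h)) s
    Module-resp eq (behind (inj₁ (h , c))) = behind (inj₁ (h , trans (sym (eq h)) c))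
    Module-resp eq (behind (inj₂ (a , b , a≢b , ua , ub))) =
      behind (inj₂ (a , b , a≢b , trans (sym (eq a)) ua , trans (sym (eq b)) ub))

    record Agrees (q : 𝔾R.Position) (p : 𝔾C.Position) : Set where
      constructor agrees
      field
        outer     : ∀ x → q (inj₁ x) ≡ p (inj₁ x)
        dominated : q (inj₂ 1F) ≡ just dominator

    record Simulates (P : Player) (q : 𝔾R.Position) (p : 𝔾C.Position) : Set where
      constructor simulates
      field
        {owner} : Maybe Player
        agree   : Agrees q p
        owns    : q (inj₂ 0F) ≡ owner
        inner   : Module P (p ∘ inj₂) owner
      open Agrees agree public

    I : Player → 𝔾C.Position → Set
    I P p = ∃[ q ] Simulates P q p × 𝔾R.WinsWaiting P q

    claim-outer : ∀ {P q p} x Q → Simulates P q p →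
                  Simulates P (𝔾R.claim q (inj₁ x) Q) (𝔾C.claim p (inj₁ x) Q)
    claim-outer {P} {q} {p} x Q (simulates (agrees out dom) own inn) = simulates
      (agrees
        (λ y → claim-cong reduced C Q (cong inj₁ ∘ inj₁-injective) (cong inj₁ ∘ inj₁-injective) (out y))
        (trans (𝔾R.claim-other q {inj₁ x} Q λ ()) dom))
      (trans (𝔾R.claim-other q {inj₁ x} Q λ ()) own)
      (Module-resp (λ h → sym (𝔾C.claim-other p {inj₁ x} Q λ ())) inn)

    claim-inner : ∀ {q p} h Q → Agrees q p → Agrees q (𝔾C.claim p (inj₂ h) Q)
    claim-inner {p = p} h Q (agrees out dom) =
      agrees (λ x → trans (out x) (sym (𝔾C.claim-other p {inj₂ h} Q λ ()))) dom

    -- This mirrors the claim that opens the play in `H`: it counts as claiming `m`. Later claims in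
    -- `H` leave `q` unchanged, as in `claim-inner`.
    claim-module : ∀ {P q p} h Q → Agrees q p →
                   Module P (𝔾C.claim p (inj₂ h) Q ∘ inj₂) (just Q) →
                   Simulates P (𝔾R.claim q (inj₂ 0F) Q) (𝔾C.claim p (inj₂ h) Q)
    claim-module {q = q} {p} h Q agr inn = simulates
      (agrees
        (λ x → trans (𝔾R.claim-other q {inj₂ 0F} {inj₁ x} Q λ ()) (Agrees.outer agr′ x))
        (trans (𝔾R.claim-other q {inj₂ 0F} Q λ ()) (Agrees.dominated agr′)))
      (𝔾R.claim-same q (inj₂ 0F) Q)
      inn
      where
      agr′ = claim-inner h Q agr

    claim-H : ∀ {p r} h Q → r ≗ p ∘ inj₂ → 𝔾H.claim r h Q ≗ 𝔾C.claim p (inj₂ h) Q ∘ inj₂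
    claim-H h Q eq k = claim-cong H C Q (cong inj₂) inj₂-injective (eq k)

    still-unclaimed : ∀ {p h k} Q → k ≢ h → 𝔾C.Unclaimed p (inj₂ k) →
                      𝔾C.Unclaimed (𝔾C.claim p (inj₂ h) Q) (inj₂ k)
    still-unclaimed {p} Q k≢h u = trans (𝔾C.claim-other p Q (k≢h ∘ inj₂-injective)) u

    respond : ∀ P {q p} → Simulates P q p → 𝔾R.WinsMoving P q → Answer C P (I P) p
    respond P sim (𝔾R.over full w) = inj₁ (_ , sim , 𝔾R.over full w)
    respond P sim (𝔾R.move (inj₁ x) u s) =
      inj₂ (inj₁ x , trans (sym (Simulates.outer sim x)) u , _ , claim-outer x P sim , s)
    respond P sim (𝔾R.move (inj₂ 1F) u s) =
      contradiction (trans (sym (Simulates.dominated sim)) u) λ ()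
    respond P (simulates agr own inn) (𝔾R.move (inj₂ 0F) u s) with trans (sym own) u | inn
    ... | refl | fresh _ (𝔾H.over full _) _   = contradiction refl (full h₀)
    -- Claiming `m` is realised by the first move of the winning strategy on `H`; from then on `P`
    -- is waiting there in a winning position.
    ... | refl | fresh free (𝔾H.move h _ t) _ =
      inj₂ (inj₂ h , free h , _ ,
            claim-module h P agr (ahead (claim-H h P (λ k → sym (free k))) t) , s)

    -- With `m` free, the opponent's claim counts as taking `m`, and the reduced strategy answers
    -- it. With `m` owned, the reduced game stands still and any answer is made inside `H`: by the
    -- strategy on `H` if `P` owns `m`, otherwise from the reserved pair.
    step-inner : ∀ P {p q s} h → Agrees q p → q (inj₂ 0F) ≡ s → Module P (p ∘ inj₂) s →
                 𝔾R.WinsWaiting P q → 𝔾C.Unclaimed p (inj₂ h) →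
                 Answer C P (I P) (𝔾C.claim p (inj₂ h) (opponent P))
    step-inner P h agr own (fresh _ _ _) (𝔾R.over full _) u = contradiction own (full (inj₂ 0F))
    step-inner P h agr own (fresh free _ two) (𝔾R.reply _ r) u with two h
    ... | a , b , a≢b , a≢h , b≢h =
      respond P (claim-module h (opponent P) agr (behind (inj₂ pair))) (r (inj₂ 0F) own)
      where
      pair = a , b , a≢b , still-unclaimed _ a≢h (free a) , still-unclaimed _ b≢h (free b)
    step-inner P h agr own (ahead eq (𝔾H.over full _)) s u = contradiction (trans (eq h) u) (full h)
    step-inner P h agr own (ahead eq (𝔾H.reply _ r)) s u with r h (trans (eq h) u)
    -- The opponent has just filled `H`, so there is no answer left inside it and `P` declines.
    ... | 𝔾H.over full w =
      inj₁ (_ , simulates (claim-inner h _ agr) own (ahead (claim-H h _ eq) (𝔾H.over full w)) , s)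
    ... | 𝔾H.move k uk t =
      inj₂ (inj₂ k , trans (sym (claim-H h _ eq k)) uk , _ ,
            simulates (claim-inner k P (claim-inner h _ agr)) own
              (ahead (claim-H k P (claim-H h _ eq)) t) , s)
    step-inner P {p} h agr own (behind (inj₁ (k , c))) s u =
      inj₁ (_ , simulates (claim-inner h _ agr) own (behind (inj₁ (k , kept))) , s)
      where
      kept : 𝔾C.ClaimedBy P (𝔾C.claim p (inj₂ h) (opponent P)) (inj₂ k)
      kept = trans (𝔾C.claim-other p {inj₂ h} _ λ where refl → contradiction (trans (sym u) c) λ ()) c
    -- At least one vertex of the pair survives the claim of `h`, and `P` takes it immediately.
    step-inner P {p} h agr own (behind (inj₂ (a , b , a≢b , ua , ub))) s u =
      inj₂ (inj₂ k , uk , _ ,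
            simulates (claim-inner k P (claim-inner h _ agr)) own
              (behind (inj₁ (k , 𝔾C.claim-same p′ (inj₂ k) P))) , s)
      where
      p′ = 𝔾C.claim p (inj₂ h) (opponent P)

      free : ∃[ k ] 𝔾C.Unclaimed p′ (inj₂ k)
      free with a H.≟ h
      ... | yes refl = b , still-unclaimed _ (a≢b ∘ sym) ub
      ... | no a≢h   = a , still-unclaimed _ a≢h ua

      k  = proj₁ free
      uk = proj₂ free

    step : ∀ P {p} v → I P p → 𝔾C.Unclaimed p v → Answer C P (I P) (𝔾C.claim p v (opponent P))
    step P (inj₁ x) (q , sim , 𝔾R.over full _) u =
      contradiction (trans (Simulates.outer sim x) u) (full (inj₁ x))
    step P (inj₁ x) (q , sim , 𝔾R.reply _ r) u =
      respond P (claim-outer x (opponent P) sim) (r (inj₁ x) (trans (Simulates.outer sim x) u))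
    step P (inj₂ h) (q , simulates agr own inn , s) u = step-inner P h agr own inn s u

    -- A vertex adjacent to `M` is dominated by any Dominator vertex of `H`, and `member` finds one.
    -- The vertices of `H` are dominated from within if Dominator won on `H`, and otherwise by the
    -- outside vertex that dominates `m`.
    final-dominator : ∀ {q p} → Simulates dominator q p → 𝔾C.Full p →
                      𝔾R.Won dominator q → 𝔾C.Won dominator p
    final-dominator {q} {p} (simulates (agrees out dom) own inn) full w =
      dominated⇒won C (C-dominated inn own)
      where
      q-dominated : Dominated reduced q
      q-dominated = won⇒dominated reduced w

      member : ∀ {s} → Module dominator (p ∘ inj₂) s → ∃[ h ] p (inj₂ h) ≡ just dominator
      member (fresh free _ _) = contradiction (free h₀) (full (inj₂ h₀))
      -- A dominating set of `H` must meet the closed neighborhood of `h₀`, so it has a member.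
      member (ahead eq t)
        with won⇒dominated H (full-waiting H (λ h u → full (inj₂ h) (trans (sym (eq h)) u)) t) h₀
      ... | h , _ , c = h , trans (sym (eq h)) c
      member (behind (inj₁ e)) = e
      member (behind (inj₂ (a , _ , _ , ua , _))) = contradiction ua (full (inj₂ a))

      C-dominated : ∀ {s} → Module dominator (p ∘ inj₂) s → q (inj₂ 0F) ≡ s → Dominated C p
      C-dominated m own (inj₁ x) with q-dominated (inj₁ x)
      ... | inj₁ z , inj₁ refl , c = inj₁ z , inj₁ refl , trans (sym (out z)) c
      ... | inj₁ z , inj₂ x~z  , c = inj₁ z , inj₂ x~z , trans (sym (out z)) c
      ... | inj₂ _ , inj₂ x~M  , c = let (h , d) = member m in inj₂ h , inj₂ x~M , d
      C-dominated (fresh free _ _) own (inj₂ h) = contradiction (free h) (full (inj₂ h))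
      C-dominated (ahead eq t) own (inj₂ h)
        with won⇒dominated H (full-waiting H (λ h u → full (inj₂ h) (trans (sym (eq h)) u)) t) h
      ... | k , inj₁ refl , c = inj₂ k , inj₁ refl , trans (sym (eq k)) c
      ... | k , inj₂ h~k  , c = inj₂ k , inj₂ h~k , trans (sym (eq k)) c
      -- Staller owns `m`, and `inj₂ 1F` is not adjacent to it. So `m` is dominated from outside, by
      -- a vertex adjacent to all of `H`.
      C-dominated (behind _) own (inj₂ h) with q-dominated (inj₂ 0F)
      ... | inj₁ z  , inj₂ M~z , c = inj₁ z , inj₂ M~z , trans (sym (out z)) c
      ... | inj₂ 0F , _        , c = contradiction (trans (sym own) c) λ ()
      ... | inj₂ 1F , inj₁ ()  , _
      ... | inj₂ 1F , inj₂ ()  , _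

    -- By contradiction, a Dominator win in `p` is turned into one in `q`. The critical vertex is
    -- `m` when Staller owns it: Staller's win on `H` leaves a vertex there that only an outside
    -- vertex adjacent to `M` can dominate, and that vertex dominates `m` too.
    final-staller : ∀ {q p} → Simulates staller q p → 𝔾C.Full p →
                    𝔾R.Won staller q → 𝔾C.Won staller p
    final-staller {q} {p} (simulates (agrees out dom) own inn) full l w =
      l (dominated⇒won reduced q-dominated)
      where
      p-dominated : Dominated C p
      p-dominated = won⇒dominated C w

      m-claimed : ∀ {s} → Module staller (p ∘ inj₂) s → q (inj₂ 0F) ≡ s →
                  (∀ z → AdjacentTo G M (proj₁ z) → p (inj₁ z) ≢ just dominator) →
                  q (inj₂ 0F) ≡ just dominator
      m-claimed (fresh free _ _) own _ = contradiction (free h₀) (full (inj₂ h₀))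
      m-claimed (behind _) own _ = own
      -- With no outside help, Dominator would dominate `H` from within, although Staller has won on
      -- `H`.
      m-claimed (ahead {r} eq t) own none = contradiction (dominated⇒won H r-dominated)
        (full-waiting H (λ h u → full (inj₂ h) (trans (sym (eq h)) u)) t)
        where
        r-dominated : Dominated H r
        r-dominated h with p-dominated (inj₂ h)
        ... | inj₁ z , inj₂ M~z  , c = contradiction c (none z M~z)
        ... | inj₂ k , inj₁ refl , c = k , inj₁ refl , trans (eq k) c
        ... | inj₂ k , inj₂ h~k  , c = k , inj₂ h~k , trans (eq k) c

      q-dominated-if : q (inj₂ 0F) ≡ just dominator ⊎
                       ∃[ z ] AdjacentTo G M (proj₁ z) × p (inj₁ z) ≡ just dominator →
                       Dominated reduced q
      q-dominated-if _ (inj₁ x) with p-dominated (inj₁ x)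
      ... | inj₁ z , inj₁ refl , c = inj₁ z , inj₁ refl , trans (out z) c
      ... | inj₁ z , inj₂ x~z  , c = inj₁ z , inj₂ x~z , trans (out z) c
      -- Whichever vertex of `H` dominates `x`, `inj₂ 1F` stands in for it.
      ... | inj₂ _ , inj₂ x~M  , c = inj₂ 1F , inj₂ x~M , dom
      q-dominated-if _ (inj₂ 1F) = inj₂ 1F , inj₁ refl , dom
      q-dominated-if (inj₁ c) (inj₂ 0F) = inj₂ 0F , inj₁ refl , c
      q-dominated-if (inj₂ (z , M~z , c)) (inj₂ 0F) = inj₁ z , inj₂ M~z , trans (out z) c

      q-dominated : Dominated reduced q
      -- No search for an outside Dominator vertex adjacent to `M` is made: any such vertex would
      -- already contradict `l`, so its absence may be assumed.
      q-dominated = q-dominated-if (inj₁ (m-claimed inn own λ z M~z c →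
        l (dominated⇒won reduced (q-dominated-if (inj₂ (z , M~z , c))))))

    final : ∀ P {p} → I P p → 𝔾C.Full p → 𝔾C.Won P p
    final P {p} (q , sim@(simulates (agrees out dom) own inn) , s) full =
      won P sim (full-waiting reduced (q-full inn own) s)
      where
      q-full : ∀ {s} → Module P (p ∘ inj₂) s → q (inj₂ 0F) ≡ s → 𝔾R.Full q
      q-full _ _ (inj₁ x) u = full (inj₁ x) (trans (sym (out x)) u)
      q-full _ _ (inj₂ 1F) u = contradiction (trans (sym dom) u) λ ()
      -- If `m` were still free, so would be all of `H`, although `p` is full.
      q-full (fresh free _ _) _ (inj₂ 0F) u = full (inj₂ h₀) (free h₀)
      q-full (ahead _ _) own (inj₂ 0F) u = contradiction (trans (sym own) u) λ ()
      q-full (behind _) own (inj₂ 0F) u = contradiction (trans (sym own) u) λ ()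

      won : ∀ P → Simulates P q p → 𝔾R.Won P q → 𝔾C.Won P p
      won dominator sim = final-dominator sim full
      won staller   sim = final-staller sim full

    module _ {o} (o-correct : 𝔾H.HasOutcome o) (large : minOrder o ≤ order H) where

      startModule : ∀ P → Module P 𝔾H.start (ownerOfModule o)
      startModule P = go o P o-correct large
        where
        free-pair : 2 ≤ order H → TwoUnclaimed 𝔾H.start
        free-pair 2≤ = let (a , b , a≢b) = distinct-pair H 2≤ in a , b , a≢b , refl , refl

        go : ∀ o P → 𝔾H.HasOutcome o → minOrder o ≤ order H → Module P 𝔾H.start (ownerOfModule o)
        go 𝒟 dominator (_ , s) _  = ahead (λ _ → refl) s
        go 𝒟 staller   _       2≤ = behind (inj₂ (free-pair 2≤))
        go 𝒮 dominator _       2≤ = behind (inj₂ (free-pair 2≤))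
        go 𝒮 staller   (_ , s) _  = ahead (λ _ → refl) s
        go 𝒩 dominator (f , _) 3≤ = fresh (λ _ → refl) f (distinct-pair-avoiding H 3≤)
        go 𝒩 staller   (_ , f) 3≤ = fresh (λ _ → refl) f (distinct-pair-avoiding H 3≤)

      startSimulates : ∀ P → Simulates P (reducedStart o) 𝔾C.start
      startSimulates P = simulates (agrees (λ _ → refl) refl) refl (startModule P)

      moving : ∀ P → 𝔾R.WinsMoving P (reducedStart o) → 𝔾C.WinsFirst P
      moving P m =
        Invariant.answer⇒moving C P (I P) (final P) (step P) (respond P (startSimulates P) m)

      waiting : ∀ P → 𝔾R.WinsWaiting P (reducedStart o) → 𝔾C.WinsSecond P
      waiting P s =
        Invariant.invariant⇒waiting C P (I P) (final P) (step P) (_ , startSimulates P , s)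

  -- Both graphs are compared with the same reduced position, which is determined. If `P` wins on
  -- the first graph, the opponent cannot win the reduced game, as that win would carry over to the
  -- first graph; so `P` wins it, and this win carries over to the second.
  replace-outcome : ∀ {H₁ H₂ o} → Game.HasOutcome H₁ o → Game.HasOutcome H₂ o →
                    minOrder o ≤ order H₁ → minOrder o ≤ order H₂ →
                    outcome (replace G M H₁) ≡ outcome (replace G M H₂)
  replace-outcome {H₁} {H₂} {o} c₁ c₂ l₁ l₂ =
    outcome-≡ (replace G M H₁) (replace G M H₂) first second
    where
    h₁ = proj₁ (distinct-pair H₁ (ℕ.≤-trans (minOrder≥2 o) l₁))
    h₂ = proj₁ (distinct-pair H₂ (ℕ.≤-trans (minOrder≥2 o) l₂))
    module S₁ = Simulation H₁ h₁
    module S₂ = Simulation H₂ h₂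
    module C₁ = Game (replace G M H₁)
    module C₂ = Game (replace G M H₂)

    first : ∀ P → C₁.WinsFirst P → C₂.WinsFirst P
    first P f with 𝔾R.determined P (reducedStart o)
    ... | inj₁ m = S₂.moving c₂ l₂ P m
    ... | inj₂ s = contradiction (S₁.waiting c₁ l₁ (opponent P) s) (C₁.exclusive P f)

    second : ∀ P → C₁.WinsSecond P → C₂.WinsSecond P
    second P s with 𝔾R.determined (opponent P) (reducedStart o)
    ... | inj₁ m = contradiction (subst C₁.WinsSecond (sym (opponent-involutive P)) s)
                                 (C₁.exclusive (opponent P) (S₁.moving c₁ l₁ (opponent P) m))
    ... | inj₂ t = S₂.waiting c₂ l₂ P
      (subst (λ Q → 𝔾R.WinsWaiting Q (reducedStart o)) (opponent-involutive P) t)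

-- The gadgets and the conclusion.

gadget-outcome : ∀ o → outcome (gadget o) ≡ o
-- `hasOutcome` is a decision procedure, so evaluating it solves the game on these small graphs.
gadget-outcome 𝒟 = refl
gadget-outcome 𝒮 = refl
gadget-outcome 𝒩 = refl

minOrder-gadget : ∀ o → minOrder o ≤ order (gadget o)
minOrder-gadget 𝒟 = ℕ.≤-refl
minOrder-gadget 𝒮 = ℕ.≤-refl
minOrder-gadget 𝒩 = ℕ.≤-refl

minOrder≤3 : ∀ o → minOrder o ≤ 3
minOrder≤3 𝒟 = s≤s (s≤s z≤n)
minOrder≤3 𝒮 = s≤s (s≤s z≤n)
minOrder≤3 𝒩 = ℕ.≤-refl

lemma4p1 : (G : Graph) (M : Subset G) → IsModule G M → 3 ≤ card G M →
    outcome G ≡ outcome (replace G M (gadget (outcome (G [ M ]))))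
lemma4p1 G M isModule 3≤M = trans (sym (replace-self G M isModule))
  -- With `G` seen as the replacement of `M` by `G [ M ]`, that graph and the gadget share the
  -- outcome `o` and are large enough to be exchanged.
  (replace-outcome G M
    (outcome-correct (G [ M ]))
    (subst (Game.HasOutcome (gadget o)) (gadget-outcome o) (outcome-correct (gadget o)))
    (ℕ.≤-trans (minOrder≤3 o) (subst (3 ≤_) (sym (order-induced G M)) 3≤M))
    (minOrder-gadget o))
  where
  o = outcome (G [ M ])
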